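{- Let $k\ge3$ and let $\pi\in\mathcal{S}_n$ be a Schröder permutation. Then $\pi$ avoids the pattern $2\,1\,3\,4\cdots k$ if and only if every element $(i,j)\in\mathcal{E}(\pi)$ satisfies $i+j\ge n+3-k+\rho(i,j)$.
   Context: A permutation avoids $\tau\in\mathcal{S}_k$ if no subsequence of length $k$ is in the same relative order as $\tau$. A Schröder permutation is one avoiding both $1243$ and $2143$. Represent $\pi\in\mathcal{S}_n$ by an $n\times n$ array, rows $i$ numbered top to bottom, columns $j$ left to right, with a dot in square $(i,\pi_i)$. The diagram $D(\pi)$ is the set of squares $(i,j)$ with $\pi_i>j$ and $\pi^{ -1}(j)>i$. The essential set $\mathcal{E}(\pi)$ is the set of $(i,j)\in D(\pi)$ with $(i+1,j)\notin D(\pi)$ and $(i,j+1)\notin D(\pi)$ (squares outside the array count as not in $D(\pi)$). The rank of $(i,j)$ is $\rho(i,j)=\#\{k'<i:\pi_{k'}<j\}$. -}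

module Defs where

open import Data.Fin using (Fin; zero; suc; toℕ; _<_)
open import Data.Fin.Patterns using (0F; 1F; 2F; 3F; 4F)
open import Data.Fin.Permutation
  using (Permutation′; id; transpose; _∘ₚ_; _⟨$⟩ʳ_; _⟨$⟩ˡ_)
open import Data.Fin.Properties using (_<?_)
open import Data.List using (length; filter; allFin)
open import Data.Nat using (ℕ; zero; suc)
open import Data.Product using (_×_; Σ-syntax)
open import Data.Vec using (Vec; []; _∷_; tabulate)
open import Function.Bundles using (_⇔_)
open import Relation.Binary.PropositionalEquality using (_≡_; refl)
open import Relation.Nullary using (¬_)
open import Relation.Nullary.Decidable using (_×-dec_)

private
  variable
    n k : ℕ

-- A permutation of {1, …, n} is a bijection of Fin n; position and value
-- number x + 1 is the element of Fin n with toℕ equal to x.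

-- s picks out the positions of a subsequence of length k.
Contains : Permutation′ n → Permutation′ k → Set
Contains {n} {k} π τ =
  Σ[ s ∈ (Fin k → Fin n) ]
    (∀ (a b : Fin k) → a < b → s a < s b) ×
    (∀ (a b : Fin k) → (π ⟨$⟩ʳ s a) < (π ⟨$⟩ʳ s b) ⇔ (τ ⟨$⟩ʳ a) < (τ ⟨$⟩ʳ b))

Avoids : Permutation′ n → Permutation′ k → Set
Avoids π τ = ¬ Contains π τ

oneLine : Permutation′ n → Vec (Fin n) n
oneLine τ = tabulate (τ ⟨$⟩ʳ_)

p1243 p2143 : Permutation′ 4
p1243 = transpose 2F 3F
p2143 = transpose 0F 1F ∘ₚ transpose 2F 3F

-- The pattern 2 1 3 4 ⋯ k; the values for k < 2 are junk.
p2134⋯ : ∀ k → Permutation′ k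
p2134⋯ zero          = id
p2134⋯ (suc zero)    = id
p2134⋯ (suc (suc k)) = transpose 0F 1F

_ : oneLine p1243 ≡ 0F ∷ 1F ∷ 3F ∷ 2F ∷ []
_ = refl

_ : oneLine p2143 ≡ 1F ∷ 0F ∷ 3F ∷ 2F ∷ []
_ = refl

_ : oneLine (p2134⋯ 5) ≡ 1F ∷ 0F ∷ 2F ∷ 3F ∷ 4F ∷ []
_ = refl

Schröder : Permutation′ n → Set
Schröder π = Avoids π p1243 × Avoids π p2143

Diagram : Permutation′ n → Fin n → Fin n → Set
Diagram π i j = j < (π ⟨$⟩ʳ i) × i < (π ⟨$⟩ˡ j)

-- In the last row (column) no i′ (j′) exists, so the condition holds vacuously:
-- squares outside the array are not in the diagram.
Essential : Permutation′ n → Fin n → Fin n → Set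
Essential {n} π i j =
  Diagram π i j ×
  (∀ (i′ : Fin n) → toℕ i′ ≡ suc (toℕ i) → ¬ Diagram π i′ j) ×
  (∀ (j′ : Fin n) → toℕ j′ ≡ suc (toℕ j) → ¬ Diagram π i j′)

rank : Permutation′ n → Fin n → Fin n → ℕ
rank {n} π i j =
  length (filter (λ r → (r <? i) ×-dec ((π ⟨$⟩ʳ r) <? j)) (allFin n))

-- The 1-based number of a row or column.
index : Fin n → ℕ
index x = suc (toℕ x)

{-# OPTIONS --safe #-}

-- Put s = #{r > i : π r > j}, the number of dots strictly south-east of (i , j).
-- For a diagram square, inclusion–exclusion gives s + i + j = n + ρ(i , j), so the
-- inequality for (i , j) says that s ≤ k − 3.
--
-- If (i , j) is essential, row i + 1 has its dot in a column ≤ j and column j + 1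
-- has its dot in a row ≤ i.  These two dots form a 21 preceding and below all dots
-- south-east of (i , j), which therefore increase, as π avoids 2143; k − 2 of them
-- complete an occurrence of 2134⋯k.
--
-- Conversely, let the "21" of an occurrence of 2134⋯k sit at positions q < p.  The
-- square (q , π p) lies in the diagram, and a diagram square which is maximal in the
-- rectangle [q , p) × [π p , π q) is essential, as row p and column π q miss the
-- diagram there.  All dots of "34⋯k" are south-east of it.
module Submission where

open import Defs
open import Data.Fin using (Fin; zero; suc; toℕ; fromℕ<; inject≤; _<_)
open import Data.Fin.Patterns using (0F; 1F; 2F)
open import Data.Fin.Permutation
  using (Permutation′; id; _⟨$⟩ʳ_; _⟨$⟩ˡ_; inverseˡ; inverseʳ)
open import Data.Fin.Properties
  using (_<?_; _≤?_; <-cmp; <-trans; <-irrefl; any?; injective⇒≤; toℕ<n; toℕ-fromℕ<;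
         fromℕ<-injective; toℕ-inject≤; inject≤-injective; toℕ-injective)
open import Data.Integer using (+_; _+_; _-_; _≥_; 0ℤ; +≤+) renaming (_≤_ to _≤ℤ_)
import Data.Integer.Properties as ℤ
open import Data.Integer.Tactic.RingSolver using (solve)
open import Data.List using (List; []; _∷_; length; filter; lookup; allFin)
open import Data.List.Membership.Propositional using (_∈_)
open import Data.List.Membership.Propositional.Properties
  using (∈-filter⁺; ∈-filter⁻; ∈-lookup; ∈-allFin)
open import Data.List.Properties using (filter-≐; length-tabulate)
import Data.List.Relation.Unary.All as All
open import Data.List.Relation.Unary.AllPairs as AllPairs using (AllPairs)
import Data.List.Relation.Unary.AllPairs.Properties as AllPairs
import Data.List.Relation.Unary.Any as Any
open import Data.List.Relation.Unary.Any.Properties using (lookup-index)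
open import Data.Nat as ℕ using (ℕ; _≤_; s≤s; z<s; s<s; s<s⁻¹)
import Data.Nat.Properties as ℕ
open import Data.Product using (_×_; _,_; ∃; ∃₂; proj₁; proj₂)
open import Data.Vec.Functional as Vector using (Vector)
open import Function using (_∘_; _$_)
open import Function.Bundles using (_⇔_; mk⇔; Equivalence)
open import Function.Definitions using (Injective)
open import Level using (0ℓ)
open import Relation.Binary using (tri<; tri≈; tri>)
open import Relation.Binary.PropositionalEquality
  using (_≡_; refl; sym; trans; cong; cong₂; subst; subst₂; module ≡-Reasoning)
open import Relation.Nullary using (¬_; Dec; yes; no; contradiction)
open import Relation.Nullary.Decidable using (_×-dec_; ¬?)
open import Relation.Unary using (Pred; Decidable)

private
  variable
    k m n : ℕ
    P Q : Pred (Fin n) 0ℓ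

-- Increasing maps between finite ordinals.

Increasing : (Fin m → Fin n) → Set
Increasing f = ∀ a b → a < b → f a < f b

increasing⇒injective : {f : Fin m → Fin n} → Increasing f → Injective _≡_ _≡_ f
increasing⇒injective f↑ {a} {b} fa≡fb with <-cmp a b
... | tri< a<b _ _ = contradiction (f↑ a b a<b) (<-irrefl fa≡fb)
... | tri≈ _ a≡b _ = a≡b
... | tri> _ _ b<a = contradiction (f↑ b a b<a) (<-irrefl (sym fa≡fb))

zero-suc-increasing : {f : Fin (ℕ.suc m) → Fin n} →
                      (∀ a → f zero < f (suc a)) → Increasing (f ∘ suc) → Increasing f
zero-suc-increasing f0< f↑ zero    (suc b) _   = f0< b
zero-suc-increasing f0< f↑ (suc a) (suc b) a<b = f↑ a b (s<s⁻¹ a<b)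

lookup-increasing : {xs : List (Fin n)} → AllPairs _<_ xs → Increasing (lookup xs)
lookup-increasing (x<xs AllPairs.∷ _)  zero    (suc b) _   =
  All.lookup x<xs (∈-lookup b)
lookup-increasing (_ AllPairs.∷ xs↑) (suc a) (suc b) a<b =
  lookup-increasing xs↑ a b (s<s⁻¹ a<b)

-- Counting the elements that satisfy a decidable predicate.

count : {P : Pred (Fin n) 0ℓ} → Decidable P → ℕ
count {n} P? = length (filter P? (allFin n))

count-cong : (P? : Decidable P) (Q? : Decidable Q) →
             (∀ {r} → P r → Q r) → (∀ {r} → Q r → P r) → count P? ≡ count Q?
count-cong P? Q? P⇒Q Q⇒P = cong length (filter-≐ P? Q? (P⇒Q , Q⇒P) (allFin _))

module _ {P : Pred (Fin n) 0ℓ} (P? : Decidable P) where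

  -- The place of `f a` in the filtered list determines `f a`, so `Fin m` embeds into the set of
  -- places of that list.
  injective⇒≤count : (f : Fin m → Fin n) → Injective _≡_ _≡_ f → (∀ a → P (f a)) →
                     m ≤ count P?
  injective⇒≤count {m = m} f f-inj Pf = injective⇒≤ {f = Any.index ∘ f∈} index-injective
    where
    xs : List (Fin n)
    xs = filter P? (allFin n)

    f∈ : ∀ a → f a ∈ xs
    f∈ a = ∈-filter⁺ P? (∈-allFin (f a)) (Pf a)

    index-injective : Injective _≡_ _≡_ (Any.index ∘ f∈)
    index-injective {a} {b} eq = f-inj $ begin
      f a                        ≡⟨ lookup-index (f∈ a) ⟩
      lookup xs (Any.index (f∈ a)) ≡⟨ cong (lookup xs) eq ⟩
      lookup xs (Any.index (f∈ b)) ≡⟨ lookup-index (f∈ b) ⟨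
      f b                        ∎
      where open ≡-Reasoning

  -- `allFin n` is strictly increasing and filtering keeps the order, so the first `m` entries of
  -- the filtered list serve as `f`.
  enumerate : m ≤ count P? → ∃ λ (f : Fin m → Fin n) → Increasing f × (∀ a → P (f a))
  enumerate m≤c = (λ a → lookup xs (inject≤ a m≤c)) , f↑ , Pf
    where
    xs : List (Fin n)
    xs = filter P? (allFin n)

    f↑ : Increasing (λ a → lookup xs (inject≤ a m≤c))
    f↑ a b a<b = lookup-increasing (AllPairs.filter⁺ P? (AllPairs.tabulate⁺-< λ i<j → i<j)) _ _ $
      subst₂ ℕ._<_ (sym (toℕ-inject≤ a m≤c)) (sym (toℕ-inject≤ b m≤c)) a<b

    Pf : ∀ a → P (lookup xs (inject≤ a m≤c))
    Pf a = proj₂ (∈-filter⁻ P? {xs = allFin n} (∈-lookup (inject≤ a m≤c)))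

+-+-suc : ∀ a b c → a ℕ.+ (b ℕ.+ ℕ.suc c) ≡ ℕ.suc (a ℕ.+ (b ℕ.+ c))
+-+-suc a b c = trans (cong (a ℕ.+_) (ℕ.+-suc b c)) (ℕ.+-suc a (b ℕ.+ c))

-- An entry adds two to each side if it satisfies both predicates, and one otherwise. The additive
-- form avoids truncated subtraction.
inclusion-exclusion : (P? : Decidable P) (Q? : Decidable Q) (xs : List (Fin n)) →
  length (filter (λ x → ¬? (P? x) ×-dec ¬? (Q? x)) xs) ℕ.+
    (length (filter P? xs) ℕ.+ length (filter Q? xs)) ≡
  length xs ℕ.+ length (filter (λ x → P? x ×-dec Q? x) xs)
inclusion-exclusion P? Q? [] = refl
inclusion-exclusion P? Q? (x ∷ xs) with ih ← inclusion-exclusion P? Q? xs | P? x | Q? x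
... | yes _ | no  _ = trans (ℕ.+-suc _ _) (cong ℕ.suc ih)
... | no  _ | no  _ = cong ℕ.suc ih
... | no  _ | yes _ = trans (+-+-suc neither _ _) (cong ℕ.suc ih)
  where
  neither : ℕ
  neither = length (filter (λ y → ¬? (P? y) ×-dec ¬? (Q? y)) xs)
... | yes _ | yes _ = trans (+-+-suc neither (ℕ.suc (length (filter P? xs))) _)
  (cong ℕ.suc (trans (ℕ.+-suc neither _) (trans (cong ℕ.suc ih) (sym (ℕ.+-suc (length xs) _)))))
  where
  neither : ℕ
  neither = length (filter (λ y → ¬? (P? y) ×-dec ¬? (Q? y)) xs)

-- Dots in an initial block of columns.

module _ (π : Permutation′ n) where

  ⟨$⟩ʳ-injective : Injective _≡_ _≡_ (π ⟨$⟩ʳ_)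
  ⟨$⟩ʳ-injective eq = trans (sym (inverseˡ π)) (trans (cong (π ⟨$⟩ˡ_) eq) (inverseˡ π))

  ⟨$⟩ˡ-injective : Injective _≡_ _≡_ (π ⟨$⟩ˡ_)
  ⟨$⟩ˡ-injective eq = trans (sym (inverseʳ π)) (trans (cong (π ⟨$⟩ʳ_) eq) (inverseʳ π))

  count-values≤ : ∀ j → count (λ r → (π ⟨$⟩ʳ r) ≤? j) ≡ ℕ.suc (toℕ j)
  count-values≤ j = ℕ.≤-antisym count≤ ≤count
    where
    -- Sending each counted row to its value embeds these rows into the values up to `j`; `≤count`
    -- uses the inverse map.
    count≤ : count (λ r → (π ⟨$⟩ʳ r) ≤? j) ≤ ℕ.suc (toℕ j)
    count≤ with f , f↑ , πf≤j ← enumerate (λ r → (π ⟨$⟩ʳ r) ≤? j) ℕ.≤-refl =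
      injective⇒≤ {f = λ a → fromℕ< (s≤s (πf≤j a))} λ eq →
        increasing⇒injective f↑ (⟨$⟩ʳ-injective (toℕ-injective (fromℕ<-injective _ _ _ _ eq)))

    value : Fin (ℕ.suc (toℕ j)) → Fin n
    value a = inject≤ a (toℕ<n j)

    ≤count : ℕ.suc (toℕ j) ≤ count (λ r → (π ⟨$⟩ʳ r) ≤? j)
    ≤count = injective⇒≤count _ (λ a → π ⟨$⟩ˡ value a)
      (λ eq → inject≤-injective _ _ _ _ (⟨$⟩ˡ-injective eq))
      (λ a → subst (ℕ._≤ toℕ j)
        (sym (trans (cong toℕ (inverseʳ π)) (toℕ-inject≤ a (toℕ<n j))))
        (ℕ.s≤s⁻¹ (toℕ<n a)))

-- Diagram squares and the dots south-east of them.

module _ (π : Permutation′ n) where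

  SouthEast : Fin n → Fin n → Fin n → Set
  SouthEast i j r = i < r × j < (π ⟨$⟩ʳ r)

  southEast? : ∀ i j → Decidable (SouthEast i j)
  southEast? i j r = (i <? r) ×-dec (j <? (π ⟨$⟩ʳ r))

  diagram? : ∀ i j → Dec (Diagram π i j)
  diagram? i j = (j <? (π ⟨$⟩ʳ i)) ×-dec (i <? (π ⟨$⟩ˡ j))

  southEast-count : ∀ {i j} → Diagram π i j →
    count (southEast? i j) ℕ.+ (index i ℕ.+ index j) ≡ n ℕ.+ rank π i j
  southEast-count {i} {j} (j<πi , i<π⁻¹j) = begin
    count (southEast? i j) ℕ.+ (index i ℕ.+ index j)
      ≡⟨ cong₂ ℕ._+_
           (count-cong (southEast? i j) (λ r → ¬? (A? r) ×-dec ¬? (B? r))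
             (λ (i<r , j<πr) → ℕ.<⇒≱ i<r , ℕ.<⇒≱ j<πr)
             (λ (r≰i , πr≰j) → ℕ.≰⇒> r≰i , ℕ.≰⇒> πr≰j))
           -- The rows up to `i` are counted as values of the identity permutation.
           (sym (cong₂ ℕ._+_ (count-values≤ id i) (count-values≤ π j))) ⟩
    count (λ r → ¬? (A? r) ×-dec ¬? (B? r)) ℕ.+ (count A? ℕ.+ count B?)
      ≡⟨ inclusion-exclusion A? B? (allFin n) ⟩
    length (allFin n) ℕ.+ count (λ r → A? r ×-dec B? r)
      ≡⟨ cong₂ ℕ._+_ (length-tabulate _)
           (count-cong (λ r → A? r ×-dec B? r) (λ r → (r <? i) ×-dec ((π ⟨$⟩ʳ r) <? j))
             strict (λ (r<i , πr<j) → ℕ.<⇒≤ r<i , ℕ.<⇒≤ πr<j)) ⟩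
    n ℕ.+ rank π i j ∎
    where
    open ≡-Reasoning

    A? : Decidable (λ r → toℕ r ≤ toℕ i)
    A? r = r ≤? i

    B? : Decidable (λ r → toℕ (π ⟨$⟩ʳ r) ≤ toℕ j)
    B? r = (π ⟨$⟩ʳ r) ≤? j

    -- Neither row i nor column j has a dot weakly north-west of a diagram square.
    strict : ∀ {r} → toℕ r ≤ toℕ i × toℕ (π ⟨$⟩ʳ r) ≤ toℕ j → r < i × (π ⟨$⟩ʳ r) < j
    strict (r≤i , πr≤j) =
      ℕ.≤∧≢⇒< r≤i (λ r≡i → ℕ.<⇒≱ j<πi
        (subst (λ x → toℕ (π ⟨$⟩ʳ x) ≤ toℕ j) (toℕ-injective r≡i) πr≤j)) ,
      ℕ.≤∧≢⇒< πr≤j (λ πr≡j → ℕ.<⇒≱ i<π⁻¹j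
        (subst (λ x → toℕ x ≤ toℕ i)
          (trans (sym (inverseˡ π)) (cong (π ⟨$⟩ˡ_) (toℕ-injective πr≡j))) r≤i))

  -- In both inequalities the larger side minus the smaller is the same integer, by `difference`,
  -- and each says that this integer is nonnegative.
  bound⇔southEast-count≤ : ∀ {k i j} → Diagram π i j →
    (+ index i + + index j ≥ + n + + 3 - + k + + rank π i j) ⇔
    3 ℕ.+ count (southEast? i j) ≤ k
  bound⇔southEast-count≤ {k} {i} {j} D = mk⇔
    (λ h → ℤ.drop‿+≤+ (ℤ.0≤i-j⇒j≤i (subst (0ℤ ≤ℤ_) difference (ℤ.i≤j⇒0≤j-i h))))
    (λ h → ℤ.0≤i-j⇒j≤i (subst (0ℤ ≤ℤ_) (sym difference) (ℤ.i≤j⇒0≤j-i (+≤+ h))))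
    where
    open ≡-Reasoning

    I J ρ s : ℕ
    I = index i
    J = index j
    ρ = rank π i j
    s = count (southEast? i j)

    regroup : ∀ I J n ρ k → I + J - (n + + 3 - k + ρ) ≡ I + J - (n + ρ) + (k - + 3)
    regroup I J n ρ k = solve (I ∷ J ∷ n ∷ ρ ∷ k ∷ [])

    cancel : ∀ I J s k → I + J - (s + (I + J)) + (k - + 3) ≡ k - (+ 3 + s)
    cancel I J s k = solve (I ∷ J ∷ s ∷ k ∷ [])

    difference : + I + + J - (+ n + + 3 - + k + + ρ) ≡ + k - (+ 3 + + s)
    difference = begin
      + I + + J - (+ n + + 3 - + k + + ρ)           ≡⟨ regroup (+ I) (+ J) (+ n) (+ ρ) (+ k) ⟩
      + I + + J - + (n ℕ.+ ρ) + (+ k - + 3)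
        -- The only step beyond ring arithmetic: `n + ρ` becomes `s + (I + J)`.
        ≡⟨ cong (λ x → + I + + J - + x + (+ k - + 3)) (southEast-count D) ⟨
      + I + + J - (+ s + (+ I + + J)) + (+ k - + 3) ≡⟨ cancel (+ I) (+ J) (+ s) (+ k) ⟩
      + k - (+ 3 + + s)                             ∎

  -- Essential squares, inversions and occurrences of patterns.

  essential-in-rectangle : ∀ {q p i j} → toℕ q ≤ toℕ i → i < p →
    toℕ (π ⟨$⟩ʳ p) ≤ toℕ j → j < (π ⟨$⟩ʳ q) → Diagram π i j →
    ∃₂ λ i′ j′ → Essential π i′ j′ × i′ < p × j′ < (π ⟨$⟩ʳ q)
  essential-in-rectangle {q} {p} = climb total (ℕ.m≤m+n total _)
    where
    total : ℕ
    total = toℕ p ℕ.+ toℕ (π ⟨$⟩ʳ q)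

    -- Moves down or right while the diagram permits. A move costs one unit of fuel and raises
    -- `i + j` by one, which preserves the bound; since `i + j < total`, the fuel cannot be
    -- exhausted.
    climb : ∀ fuel {i j} → total ≤ fuel ℕ.+ (toℕ i ℕ.+ toℕ j) →
      toℕ q ≤ toℕ i → i < p → toℕ (π ⟨$⟩ʳ p) ≤ toℕ j → j < (π ⟨$⟩ʳ q) → Diagram π i j →
      ∃₂ λ i′ j′ → Essential π i′ j′ × i′ < p × j′ < (π ⟨$⟩ʳ q)
    climb ℕ.zero bound _ i<p _ j<πq _ = contradiction bound (ℕ.<⇒≱ (ℕ.+-mono-< i<p j<πq))
    climb (ℕ.suc fuel) {i} {j} bound q≤i i<p πp≤j j<πq D
      with any? (λ i′ → (toℕ i′ ℕ.≟ ℕ.suc (toℕ i)) ×-dec diagram? i′ j)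
         | any? (λ j′ → (toℕ j′ ℕ.≟ ℕ.suc (toℕ j)) ×-dec diagram? i j′)
    ... | yes (i′ , i′≡1+i , D′@(j<πi′ , _)) | _ =
      climb fuel
        (subst (total ≤_)
          (trans (sym (ℕ.+-suc fuel _)) (cong (λ x → fuel ℕ.+ (x ℕ.+ toℕ j)) (sym i′≡1+i))) bound)
        (ℕ.≤-trans q≤i (ℕ.≤-trans (ℕ.n≤1+n _) (ℕ.≤-reflexive (sym i′≡1+i))))
        -- The new row is not `p`: the dot of row `p` lies weakly left of column `j`, so `(p , j)`
        -- is outside the diagram.
        (ℕ.≤∧≢⇒< (subst (_≤ toℕ p) (sym i′≡1+i) i<p)
          (λ i′≡p → ℕ.<⇒≱ (subst (λ x → j < (π ⟨$⟩ʳ x)) (toℕ-injective i′≡p) j<πi′) πp≤j))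
        πp≤j j<πq D′
    ... | no _ | yes (j′ , j′≡1+j , D′@(_ , i<π⁻¹j′)) =
      climb fuel
        (subst (total ≤_)
          (trans (sym (ℕ.+-suc fuel _)) (cong (fuel ℕ.+_)
            (trans (sym (ℕ.+-suc _ _)) (cong (toℕ i ℕ.+_) (sym j′≡1+j))))) bound)
        q≤i i<p
        (ℕ.≤-trans πp≤j (ℕ.≤-trans (ℕ.n≤1+n _) (ℕ.≤-reflexive (sym j′≡1+j))))
        -- The new column is not that of the dot in row `q`, since this dot lies weakly above row
        -- `i`.
        (ℕ.≤∧≢⇒< (subst (_≤ toℕ (π ⟨$⟩ʳ q)) (sym j′≡1+j) j<πq)
          (λ j′≡πq → ℕ.<⇒≱
            (subst (i <_) (trans (cong (π ⟨$⟩ˡ_) (toℕ-injective j′≡πq)) (inverseˡ π)) i<π⁻¹j′) q≤i))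
        D′
    ... | no noRow | no noCol =
      i , j ,
      (D , (λ i′ eq D′ → noRow (i′ , eq , D′)) , (λ j′ eq D′ → noCol (j′ , eq , D′))) ,
      i<p , j<πq

  essential⇒inversion : ∀ {i j} → Essential π i j →
    ∃₂ λ q p → q < p × (π ⟨$⟩ʳ p) < (π ⟨$⟩ʳ q) ×
      (∀ {r} → SouthEast i j r → p < r × (π ⟨$⟩ʳ q) < (π ⟨$⟩ʳ r))
  essential⇒inversion {i} {j} ((j<πi , i<π⁻¹j) , noRow , noCol) =
    q , p , q<p , πp<πq , below
    where
    -- The next row exists because the dot of column `j` lies below row `i`; likewise for the next
    -- column.
    1+i<n : ℕ.suc (toℕ i) ℕ.< n
    1+i<n = ℕ.≤-<-trans i<π⁻¹j (toℕ<n _)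

    1+j<n : ℕ.suc (toℕ j) ℕ.< n
    1+j<n = ℕ.≤-<-trans j<πi (toℕ<n _)

    p j⁺ q : Fin n
    p = fromℕ< 1+i<n
    j⁺ = fromℕ< 1+j<n
    q = π ⟨$⟩ˡ j⁺

    p≡1+i : toℕ p ≡ ℕ.suc (toℕ i)
    p≡1+i = toℕ-fromℕ< 1+i<n

    πq≡1+j : toℕ (π ⟨$⟩ʳ q) ≡ ℕ.suc (toℕ j)
    πq≡1+j = trans (cong toℕ (inverseʳ π)) (toℕ-fromℕ< 1+j<n)

    -- Otherwise row `p` has its dot right of column `j`, so the dot of column `j` lies below row
    -- `p`. Then `(p , j)` is in the diagram, against essentiality. The proof of `q≤i` is the
    -- transpose.
    πp≤j : toℕ (π ⟨$⟩ʳ p) ≤ toℕ j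
    πp≤j = ℕ.≮⇒≥ λ j<πp → noRow p p≡1+i (j<πp , ℕ.≤∧≢⇒< (subst (_≤ _) (sym p≡1+i) i<π⁻¹j)
      (λ p≡π⁻¹j → <-irrefl
        (trans (sym (inverseʳ π)) (cong (π ⟨$⟩ʳ_) (sym (toℕ-injective p≡π⁻¹j)))) j<πp))

    q≤i : toℕ q ≤ toℕ i
    q≤i = ℕ.≮⇒≥ λ i<q → noCol j⁺ (toℕ-fromℕ< 1+j<n)
      (ℕ.≤∧≢⇒< (subst (_≤ _) (sym (toℕ-fromℕ< 1+j<n)) j<πi)
        (λ j⁺≡πi → <-irrefl
          (trans (sym (inverseˡ π)) (cong (π ⟨$⟩ˡ_) (sym (toℕ-injective j⁺≡πi)))) i<q)
      , i<q)

    q<p : q < p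
    q<p = subst (toℕ q ℕ.<_) (sym p≡1+i) (s≤s q≤i)

    πp<πq : (π ⟨$⟩ʳ p) < (π ⟨$⟩ʳ q)
    πp<πq = subst (toℕ (π ⟨$⟩ʳ p) ℕ.<_) (sym πq≡1+j) (s≤s πp≤j)

    -- A dot south-east of `(i , j)` can lie neither in row `i + 1` nor in column `j + 1`, whose
    -- dots are at `p` and `q`.
    below : ∀ {r} → SouthEast i j r → p < r × (π ⟨$⟩ʳ q) < (π ⟨$⟩ʳ r)
    below {r} (i<r , j<πr) =
      ℕ.≤∧≢⇒< (subst (_≤ toℕ r) (sym p≡1+i) i<r)
        (λ p≡r → ℕ.<⇒≱ j<πr (subst (λ x → toℕ (π ⟨$⟩ʳ x) ≤ toℕ j) (toℕ-injective p≡r) πp≤j)) ,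
      ℕ.≤∧≢⇒< (subst (_≤ toℕ (π ⟨$⟩ʳ r)) (sym πq≡1+j) j<πr)
        (λ πq≡πr → ℕ.<⇒≱ i<r
          (subst (λ x → toℕ x ≤ toℕ i) (⟨$⟩ʳ-injective π (toℕ-injective πq≡πr)) q≤i))

  -- The inverse of `τ` lists the chosen dots by increasing value. Monotonicity along this list
  -- gives one direction of the order equivalence, and trichotomy turns it into the other.
  contains : (τ : Permutation′ k) (s : Fin k → Fin n) → Increasing s →
             Increasing (λ c → π ⟨$⟩ʳ s (τ ⟨$⟩ˡ c)) → Contains π τ
  contains τ s s↑ v↑ = s , s↑ , λ a b → mk⇔ (reflects a b) (preserves a b)
    where
    preserves : ∀ a b → (τ ⟨$⟩ʳ a) < (τ ⟨$⟩ʳ b) → (π ⟨$⟩ʳ s a) < (π ⟨$⟩ʳ s b)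
    preserves a b τa<τb = subst₂ (λ x y → (π ⟨$⟩ʳ s x) < (π ⟨$⟩ʳ s y))
      (inverseˡ τ) (inverseˡ τ) (v↑ (τ ⟨$⟩ʳ a) (τ ⟨$⟩ʳ b) τa<τb)

    reflects : ∀ a b → (π ⟨$⟩ʳ s a) < (π ⟨$⟩ʳ s b) → (τ ⟨$⟩ʳ a) < (τ ⟨$⟩ʳ b)
    reflects a b πsa<πsb with <-cmp (τ ⟨$⟩ʳ a) (τ ⟨$⟩ʳ b)
    ... | tri< τa<τb _ _ = τa<τb
    ... | tri≈ _ τa≡τb _ = contradiction πsa<πsb
      (<-irrefl (cong (λ x → π ⟨$⟩ʳ s x)
        (trans (sym (inverseˡ τ)) (trans (cong (τ ⟨$⟩ˡ_) τa≡τb) (inverseˡ τ)))))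
    ... | tri> _ _ τb<τa = contradiction (<-trans πsa<πsb (preserves b a τb<τa)) (<-irrefl refl)

  module _ {q p : Fin n} (q<p : q < p) (πp<πq : (π ⟨$⟩ʳ p) < (π ⟨$⟩ʳ q)) where

    southEast-increasing : Avoids π p2143 →
      ∀ {a b} → p < a → a < b → (π ⟨$⟩ʳ q) < (π ⟨$⟩ʳ a) → (π ⟨$⟩ʳ q) < (π ⟨$⟩ʳ b) →
      (π ⟨$⟩ʳ a) < (π ⟨$⟩ʳ b)
    southEast-increasing av {a} {b} p<a a<b πq<πa πq<πb with <-cmp (π ⟨$⟩ʳ a) (π ⟨$⟩ʳ b)
    ... | tri< πa<πb _ _ = πa<πb
    ... | tri≈ _ πa≡πb _ = contradiction a<b (<-irrefl (⟨$⟩ʳ-injective π πa≡πb))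
    ... | tri> _ _ πb<πa = contradiction (contains p2143 s s↑ v↑) av
      where
      s : Vector (Fin n) 4
      s = q Vector.∷ p Vector.∷ a Vector.∷ b Vector.∷ Vector.[]

      s↑ : Increasing s
      s↑ = zero-suc-increasing
             (λ { 0F → q<p ; 1F → <-trans q<p p<a ; 2F → <-trans q<p (<-trans p<a a<b) })
             (zero-suc-increasing (λ { 0F → p<a ; 1F → <-trans p<a a<b })
               (zero-suc-increasing (λ { 0F → a<b }) λ { 0F 0F () }))

      -- By increasing value, the positions are `p`, `q`, `b`, `a`.
      v↑ : Increasing (λ c → π ⟨$⟩ʳ s (p2143 ⟨$⟩ˡ c))
      v↑ = zero-suc-increasing
             (λ { 0F → πp<πq ; 1F → <-trans πp<πq πq<πb ; 2F → <-trans πp<πq πq<πa })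
             (zero-suc-increasing (λ { 0F → πq<πb ; 1F → πq<πa })
               (zero-suc-increasing (λ { 0F → πb<πa }) λ { 0F 0F () }))

    contains-2134⋯ : (f : Fin k → Fin n) → Increasing f → Increasing (λ a → π ⟨$⟩ʳ f a) →
      (∀ a → p < f a) → (∀ a → (π ⟨$⟩ʳ q) < (π ⟨$⟩ʳ f a)) →
      Contains π (p2134⋯ (2 ℕ.+ k))
    contains-2134⋯ {k} f f↑ πf↑ p<f πq<πf = contains (p2134⋯ (2 ℕ.+ k)) s s↑ v↑
      where
      s : Vector (Fin n) (2 ℕ.+ k)
      s = q Vector.∷ p Vector.∷ f

      s↑ : Increasing s
      s↑ = zero-suc-increasing (λ { zero → q<p ; (suc a) → <-trans q<p (p<f a) })
             (zero-suc-increasing p<f f↑)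

      -- The transposition is its own inverse, so the values are read at `p`, `q` and then along
      -- `f`.
      v↑ : Increasing (λ c → π ⟨$⟩ʳ s (p2134⋯ (2 ℕ.+ k) ⟨$⟩ˡ c))
      v↑ = zero-suc-increasing
             (λ { zero → πp<πq ; (suc a) → <-trans πp<πq (πq<πf a) })
             (zero-suc-increasing πq<πf πf↑)

theorem3p3 : ∀ (k n : ℕ) → 3 ≤ k → (π : Permutation′ n) → Schröder π →
    Avoids π (p2134⋯ k) ⇔
    (∀ (i j : Fin n) → Essential π i j →
    + index i + + index j ≥ + n + + 3 - + k + + rank π i j)
theorem3p3 k@(ℕ.suc (ℕ.suc (ℕ.suc m))) n (s≤s (s≤s (s≤s _))) π (_ , avoids2143) = mk⇔ to from
  where
  to : Avoids π (p2134⋯ k) → ∀ i j → Essential π i j →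
       + index i + + index j ≥ + n + + 3 - + k + + rank π i j
  to avoids i j ess = Equivalence.from (bound⇔southEast-count≤ π (proj₁ ess)) $ ℕ.≮⇒≥ λ k<3+s →
    let q , p , q<p , πp<πq , below = essential⇒inversion π ess
        -- As `k` is `3 + m`, a failing bound leaves at least `1 + m = k - 2` dots south-east,
        -- enough for the "34⋯k".
        f , f↑ , SE = enumerate (southEast? π i j) (ℕ.+-cancelˡ-≤ 3 (1 ℕ.+ m) _ k<3+s)
        p<f = proj₁ ∘ below ∘ SE
        πq<πf = proj₂ ∘ below ∘ SE
    in avoids $ contains-2134⋯ π q<p πp<πq f f↑
         (λ a b a<b → southEast-increasing π q<p πp<πq avoids2143
           (p<f a) (f↑ a b a<b) (πq<πf a) (πq<πf b))
         p<f πq<πf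

  from : (∀ i j → Essential π i j →
          + index i + + index j ≥ + n + + 3 - + k + + rank π i j) →
         Avoids π (p2134⋯ k)
  from bounded (s , s↑ , order) =
    -- The climb starts at `(q , π p)`, the corner of the inversion.
    let i , j , ess , i<p , j<πq = essential-in-rectangle π {q} {p} ℕ.≤-refl q<p ℕ.≤-refl πp<πq
          (πp<πq , subst (q <_) (sym (inverseˡ π)) q<p)
        3+s≤k = Equivalence.to (bound⇔southEast-count≤ π (proj₁ ess)) (bounded i j ess)
        -- The "34⋯k" contributes `1 + m` dots south-east of `(i , j)`, while the bound allows only
        -- `m`.
        1+m≤s = injective⇒≤count (southEast? π i j) rest rest-injective λ a →
          <-trans i<p (s↑ 1F (suc (suc a)) (s<s z<s)) ,
          <-trans j<πq (Equivalence.from (order 0F (suc (suc a))) (s<s z<s))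
    in ℕ.1+n≰n (ℕ.≤-trans (ℕ.+-monoʳ-≤ 3 1+m≤s) 3+s≤k)
    where
    q p : Fin n
    q = s 0F
    p = s 1F

    q<p : q < p
    q<p = s↑ 0F 1F z<s

    πp<πq : (π ⟨$⟩ʳ p) < (π ⟨$⟩ʳ q)
    πp<πq = Equivalence.from (order 1F 0F) z<s

    rest : Fin (1 ℕ.+ m) → Fin n
    rest a = s (suc (suc a))

    rest-injective : Injective _≡_ _≡_ rest
    rest-injective = increasing⇒injective (λ a b a<b → s↑ (suc (suc a)) (suc (suc b)) (s<s (s<s a<b)))
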